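{- For all $n\ge2$, the map $\psi$ is a bijection from the set of 1-terminal chord diagrams of size $n$ to the set of all (not necessarily connected) chord diagrams of size $n-1$.
   Context: A chord diagram of size $n$ is a perfect matching of $\{1,\dots,2n\}$; chords are ordered pairs $(a,b)$ with $a<b$, $a$ the source and $b$ the sink. For chords $c_1=(a_1,b_1)$, $c_2=(a_2,b_2)$ with $a_1<a_2$, they cross if $a_2<b_1<b_2$, and then $c_2$ is a right neighbor of $c_1$. A chord is terminal if it has no right neighbors. A diagram is 1-terminal if no chord other than the last one, in the order of sources, is terminal. The map $\psi$: let $T$ be a 1-terminal diagram of size $n\ge2$ with chords $c_1<\dots<c_n$ ordered by source. The source-sink group of a chord $c$ consists of the source of $c$ together with the maximal run of consecutive sinks immediately following it (excluding the sink of $c$ itself). Then $\psi(T)$ is the diagram obtained from $T$ by (1) moving each source to the end of its source-sink group (all other endpoints keeping their relative order and every source staying paired with its sink), and (2) deleting the terminal chord $c_n$; endpoints are then relabelled order-preservingly. -}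

module Defs where

open import Data.Fin.Base using (Fin; zero; suc; cast; _<_)
open import Data.Fin.Properties
  using (_≟_; _<?_; ≤-totalOrder; injective⇒≤; cast-involutive)
open import Data.List.Base
  using (List; []; _∷_; length; lookup; filter; allFin)
open import Data.List.Extrema using (max)
open import Data.List.Membership.Propositional using (_∈_)
open import Data.List.Membership.Propositional.Properties
  using (∈-allFin; ∈-lookup; ∈-filter⁺; ∈-filter⁻)
open import Data.List.Membership.Setoid.Properties using (index-injective)
open import Data.List.Relation.Binary.Permutation.Propositional
  using (_↭_; ↭-refl; ↭-sym; ↭-trans; ↭-prep; ↭-swap; ↭⇒↭ₛ)
open import Data.List.Relation.Binary.Permutation.Propositional.Properties
  using (∈-resp-↭)
open import Data.List.Relation.Binary.Permutation.Setoid.Properties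
  using (Unique-resp-↭)
open import Data.List.Relation.Unary.All as All using (_∷_)
open import Data.List.Relation.Unary.AllPairs using (_∷_)
open import Data.List.Relation.Unary.Any using (here; there; index)
open import Data.List.Relation.Unary.Any.Properties using (lookup-index)
open import Data.List.Relation.Unary.Unique.Propositional using (Unique)
import Data.List.Relation.Unary.Unique.Propositional.Properties as Unique
open import Data.Nat.Base using (ℕ; zero; suc; _*_; _∸_)
import Data.Nat.Base as ℕ
open import Data.Nat.Properties using (suc-injective; ≤-antisym)
open import Data.Product.Base using (Σ; _×_; _,_; proj₁; proj₂; ∃-syntax)
open import Data.Sum.Base using (_⊎_; inj₁; inj₂)
open import Function.Base using (_∘_; _on_)
open import Relation.Binary.PropositionalEquality
  using (_≡_; _≢_; refl; sym; trans; cong; setoid)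
open import Relation.Nullary using (¬_; Dec; yes; no; contradiction)
open import Relation.Nullary.Decidable using (¬?; _×-dec_; _⊎-dec_)

-- A perfect matching of the 2n endpoints, numbered from 0, given by the map
-- sending each endpoint to the other endpoint of its chord.
record Diagram (n : ℕ) : Set where
  field
    partner     : Fin (n * 2) → Fin (n * 2)
    involutive  : ∀ x → partner (partner x) ≡ x
    irreflexive : ∀ x → partner x ≢ x

open Diagram public

infix 4 _≈_

_≈_ : ∀ {n} → Diagram n → Diagram n → Set
D ≈ E = ∀ x → partner D x ≡ partner E x

module _ {n : ℕ} (T : Diagram n) where

  IsSource IsSink : Fin (n * 2) → Set
  IsSource x = x < partner T x
  IsSink   x = partner T x < x

  isSource? : ∀ x → Dec (IsSource x)
  isSource? x = x <? partner T x

  isSink? : ∀ x → Dec (IsSink x)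
  isSink? x = partner T x <? x

  record Chord : Set where
    field
      source   : Fin (n * 2)
      sink     : Fin (n * 2)
      ordered  : source < sink
      paired   : partner T source ≡ sink

  open Chord

  RightNeighbour : Chord → Chord → Set
  RightNeighbour c₁ c₂ =
    source c₁ < source c₂ × source c₂ < sink c₁ × sink c₁ < sink c₂

  Terminal : Chord → Set
  Terminal c = ¬ (∃[ d ] RightNeighbour c d)

  Last : Chord → Set
  Last c = ∀ d → ¬ (source c < source d)

  OneTerminal : Set
  OneTerminal = ∀ c → ¬ Last c → ¬ Terminal c

OneTerminalDiagram : ℕ → Set
OneTerminalDiagram n = Σ (Diagram n) OneTerminal

infix 4 _≈₁_

_≈₁_ : ∀ {n} → OneTerminalDiagram n → OneTerminalDiagram n → Set
_≈₁_ = _≈_ on proj₁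

module _ {n : ℕ} (T : Diagram n) where

  private
    Point : Set
    Point = Fin (n * 2)

  -- InRun s y: y may be passed by the source s.  The source-sink group of s is
  -- s followed by the longest block of such endpoints directly after it.
  InRun : Point → Point → Set
  InRun s y = IsSink T y × y ≢ partner T s

  inRun? : ∀ s y → Dec (InRun s y)
  inRun? s y = isSink? T y ×-dec ¬? (y ≟ partner T s)

  -- On the list of endpoints in increasing order, moveSources gives their order
  -- after each source has been moved to the end of its group.  The groups are
  -- those of the original diagram: carry s xs moves s past the run of its group
  -- at the front of xs, before any later source has been moved.
  moveSources : List Point → List Point
  carry       : Point → List Point → List Point

  moveSources []       = []
  moveSources (x ∷ xs) with isSource? T x
  ... | yes _ = carry x xs
  ... | no  _ = x ∷ moveSources xs

  carry s []       = s ∷ []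
  carry s (y ∷ ys) with inRun? s y | isSource? T y
  ... | yes _ | _     = y ∷ carry s ys
  ... | no  _ | yes _ = s ∷ carry y ys
  ... | no  _ | no  _ = s ∷ y ∷ moveSources ys

  moveSources-↭ : ∀ xs → moveSources xs ↭ xs
  carry-↭       : ∀ s xs → carry s xs ↭ s ∷ xs

  moveSources-↭ []       = ↭-refl
  moveSources-↭ (x ∷ xs) with isSource? T x
  ... | yes _ = carry-↭ x xs
  ... | no  _ = ↭-prep x (moveSources-↭ xs)

  carry-↭ s []       = ↭-refl
  carry-↭ s (y ∷ ys) with inRun? s y | isSource? T y
  ... | yes _ | _     = ↭-trans (↭-prep y (carry-↭ s ys)) (↭-swap y s ↭-refl)
  ... | no  _ | yes _ = ↭-prep s (carry-↭ y ys)
  ... | no  _ | no  _ = ↭-prep s (↭-prep y (moveSources-↭ ys))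

  arrangement : List Point
  arrangement = moveSources (allFin (n * 2))

  ∈-arrangement : ∀ x → x ∈ arrangement
  ∈-arrangement x = ∈-resp-↭ (↭-sym (moveSources-↭ _)) (∈-allFin x)

  arrangement-unique : Unique arrangement
  arrangement-unique =
    Unique-resp-↭ (setoid Point) (↭⇒↭ₛ (↭-sym (moveSources-↭ _)))
      (Unique.allFin⁺ (n * 2))

lookup-injective : ∀ {A : Set} {xs : List A} → Unique xs →
                   ∀ i j → lookup xs i ≡ lookup xs j → i ≡ j
lookup-injective (x∉ ∷ u) zero    zero    eq = refl
lookup-injective (x∉ ∷ u) zero    (suc j) eq =
  contradiction eq (All.lookup x∉ (∈-lookup j))
lookup-injective (x∉ ∷ u) (suc i) zero    eq =
  contradiction (sym eq) (All.lookup x∉ (∈-lookup i))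
lookup-injective (x∉ ∷ u) (suc i) (suc j) eq = cong suc (lookup-injective u i j eq)

-- The diagram formed by the endpoints listed in L, relabelled by their
-- positions in L; chords join the same endpoints as in T.
module Relabel {m n : ℕ} (T : Diagram m) (L : List (Fin (m * 2)))
               (unique : Unique L)
               (closed : ∀ {x} → x ∈ L → partner T x ∈ L)
               (len : length L ≡ n * 2) where

  endpoint : Fin (n * 2) → Fin (m * 2)
  endpoint i = lookup L (cast (sym len) i)

  position : ∀ {x} → x ∈ L → Fin (n * 2)
  position x∈L = cast len (index x∈L)

  endpoint-∈ : ∀ i → endpoint i ∈ L
  endpoint-∈ i = ∈-lookup (cast (sym len) i)

  endpoint-position : ∀ {x} (x∈L : x ∈ L) → endpoint (position x∈L) ≡ x
  endpoint-position x∈L = trans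
    (cong (lookup L) (cast-involutive (sym len) len (index x∈L)))
    (sym (lookup-index x∈L))

  endpoint-injective : ∀ {i j} → endpoint i ≡ endpoint j → i ≡ j
  endpoint-injective {i} {j} eq = trans (sym (cast-involutive len (sym len) i))
    (trans (cong (cast len) (lookup-injective unique _ _ eq))
           (cast-involutive len (sym len) j))

  partner′ : Fin (n * 2) → Fin (n * 2)
  partner′ i = position (closed (endpoint-∈ i))

  endpoint-partner′ : ∀ i → endpoint (partner′ i) ≡ partner T (endpoint i)
  endpoint-partner′ i = endpoint-position (closed (endpoint-∈ i))

  relabel : Diagram n
  relabel = record
    { partner     = partner′
    ; involutive  = λ i → endpoint-injective
        (trans (endpoint-partner′ (partner′ i))
        (trans (cong (partner T) (endpoint-partner′ i))
               (involutive T (endpoint i))))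
    ; irreflexive = λ i eq → irreflexive T (endpoint i)
        (trans (sym (endpoint-partner′ i)) (cong endpoint eq))
    }

module _ {n : ℕ} (T : Diagram (suc n)) where

  private
    Point : Set
    Point = Fin (suc n * 2)

  -- zero, which is always a source, only serves as the default value of max.
  lastSource : Point
  lastSource = max (≤-totalOrder _) zero (filter (isSource? T) (allFin _))

  lastSink : Point
  lastSink = partner T lastSource

  OnLastChord : Point → Set
  OnLastChord x = x ≡ lastSource ⊎ x ≡ lastSink

  onLastChord? : ∀ x → Dec (OnLastChord x)
  onLastChord? x = (x ≟ lastSource) ⊎-dec (x ≟ lastSink)

  remaining : List Point
  remaining = filter (¬? ∘ onLastChord?) (arrangement T)

  remaining-unique : Unique remaining
  remaining-unique = Unique.filter⁺ (¬? ∘ onLastChord?) (arrangement-unique T)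

  ∈-remaining : ∀ {x} → ¬ OnLastChord x → x ∈ remaining
  ∈-remaining {x} = ∈-filter⁺ (¬? ∘ onLastChord?) (∈-arrangement T x)

  remaining-∉ : ∀ {x} → x ∈ remaining → ¬ OnLastChord x
  remaining-∉ x∈ = proj₂ (∈-filter⁻ (¬? ∘ onLastChord?) {xs = arrangement T} x∈)

  remaining-closed : ∀ {x} → x ∈ remaining → partner T x ∈ remaining
  remaining-closed {x} x∈ = ∈-remaining λ where
    (inj₁ eq) → remaining-∉ x∈ (inj₂ (trans (sym (involutive T x)) (cong (partner T) eq)))
    (inj₂ eq) → remaining-∉ x∈ (inj₁ (trans (sym (involutive T x))
                  (trans (cong (partner T) eq) (involutive T lastSource))))

  remaining-length : length remaining ≡ n * 2
  remaining-length = suc-injective (suc-injective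
    (≤-antisym
      (injective⇒≤ (lookup-injective unique _ _))
      (injective⇒≤ (index-injective (setoid Point) (all∈ _) (all∈ _)))))
    where
    unique : Unique (lastSource ∷ lastSink ∷ remaining)
    unique =
      ((λ eq → irreflexive T lastSource (sym eq)) ∷
        All.tabulate (λ x∈ eq → remaining-∉ x∈ (inj₁ (sym eq)))) ∷
      All.tabulate (λ x∈ eq → remaining-∉ x∈ (inj₂ (sym eq))) ∷
      remaining-unique

    all∈ : ∀ x → x ∈ lastSource ∷ lastSink ∷ remaining
    all∈ x with onLastChord? x
    ... | yes (inj₁ eq) = here eq
    ... | yes (inj₂ eq) = there (here eq)
    ... | no  x∉        = there (there (∈-remaining x∉))

  moveAndDelete : Diagram n
  moveAndDelete =
    Relabel.relabel T remaining remaining-unique remaining-closed remaining-length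

ψ : ∀ {n} → 2 ℕ.≤ n → OneTerminalDiagram n → Diagram (n ∸ 1)
ψ {suc n} _ (T , _) = moveAndDelete T

{-# OPTIONS --safe #-}
module Submission where

-- If T is 1-terminal, its last endpoint belongs to the last chord (the chord that
-- ends there is terminal), and no other chord closes inside its own source-sink
-- group (it would be terminal).  So, as words in sources sᵢ, blocks Aᵢ of sinks and
-- the sink b of the last chord,
--   T = s₁ A₁ s₂ A₂ … sₙ Aₙ b   and   ψ T = A₁ s₁ A₂ s₂ … Aₙ₋₁ sₙ₋₁ Aₙ,  A₁ empty.
-- With positions numbered from 0, a sink at position k of ψ T is at position k + 1
-- of T.  If position k of ψ T is a source, then position k + 1 of T is a source too,
-- and the moved source is the last one of T before it.  The sources of ψ T thus
-- determine those of T, and undoing the shift turns any diagram into a 1-terminal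
-- one: the last source before the sink of a chord that is not the last has its own
-- sink further right.

open import Defs
open import Data.Bool.Base using (Bool; true; false; if_then_else_)
open import Data.Fin.Base using (Fin; zero; suc; toℕ; fromℕ<)
open import Data.Fin.Properties
  using (fromℕ<-toℕ; toℕ-fromℕ<; toℕ<n; toℕ-injective; toℕ-cast; ≤-totalOrder)
open import Data.List.Base using (List; []; _∷_; length; lookup; filter; allFin; tabulate)
open import Data.List.Extrema using (argmax-sel; xs≤max)
open import Data.List.Membership.Propositional.Properties using (∈-allFin; ∈-filter⁺; ∈-filter⁻)
open import Data.List.Properties using (filter-accept; filter-reject; length-tabulate)
import Data.List.Relation.Unary.All as All
open import Data.Nat.Base
  using (ℕ; zero; suc; _+_; _*_; _≤_; _<_; _<ᵇ_; z≤n; s≤s; z<s; s<s; s<s⁻¹; s≤s⁻¹)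
open import Data.Nat.Properties hiding (≤-totalOrder)
open import Data.Product.Base using (∃; _×_; _,_; proj₁; proj₂)
open import Data.Sum.Base using (_⊎_; inj₁; inj₂)
open import Function.Base using (_∘_; id)
open import Function.Structures using (IsBijection)
open import Relation.Binary.Structures using (IsEquivalence)
import Relation.Binary.Construct.On as On
open import Relation.Binary.Definitions using (tri<; tri≈; tri>)
open import Relation.Binary.PropositionalEquality
open import Relation.Nullary using (¬_; Dec; yes; no; contradiction)
open import Relation.Nullary.Decidable using (¬?)

-- Boolean comparison of natural numbers.

<ᵇ-true : ∀ {m n} → m < n → (m <ᵇ n) ≡ true
<ᵇ-true {zero}  {suc n} _   = refl
<ᵇ-true {suc m} {suc n} m<n = <ᵇ-true (s<s⁻¹ m<n)

<ᵇ-false : ∀ {m n} → n ≤ m → (m <ᵇ n) ≡ false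
<ᵇ-false {m}     {zero}  _   = refl
<ᵇ-false {suc m} {suc n} n≤m = <ᵇ-false (s≤s⁻¹ n≤m)

<ᵇ-true⁻¹ : ∀ {m n} → (m <ᵇ n) ≡ true → m < n
<ᵇ-true⁻¹ {zero}  {suc n} _  = z<s
<ᵇ-true⁻¹ {suc m} {suc n} eq = s<s (<ᵇ-true⁻¹ eq)

<ᵇ-false⁻¹ : ∀ {m n} → (m <ᵇ n) ≡ false → n ≤ m
<ᵇ-false⁻¹ {m}     {zero}  _  = z≤n
<ᵇ-false⁻¹ {suc m} {suc n} eq = s≤s (<ᵇ-false⁻¹ eq)

-- Positions of endpoints before and after the sources are moved.

-- S k says that position suc k of the larger diagram T is a source; position 0
-- always is one.  latest k is the last source at a position ≤ k.
module Slots (S : ℕ → Bool) where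

  latest : ℕ → ℕ
  latest zero    = zero
  latest (suc k) = if S k then suc k else latest k

  -- The position in T of the endpoint that is at position k of ψ T.
  slot : ℕ → ℕ
  slot k = if S k then latest k else suc k

  latest-source : ∀ k → S k ≡ true → latest (suc k) ≡ suc k
  latest-source k Sk rewrite Sk = refl

  latest-sink : ∀ k → S k ≡ false → latest (suc k) ≡ latest k
  latest-sink k Sk rewrite Sk = refl

  slot-source : ∀ k → S k ≡ true → slot k ≡ latest k
  slot-source k Sk rewrite Sk = refl

  slot-sink : ∀ k → S k ≡ false → slot k ≡ suc k
  slot-sink k Sk rewrite Sk = refl

  latest≤ : ∀ k → latest k ≤ k
  latest≤ zero = z≤n
  latest≤ (suc k) with S k
  ... | true  = ≤-refl
  ... | false = m≤n⇒m≤1+n (latest≤ k)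

  slot≤ : ∀ k → slot k ≤ suc k
  slot≤ k with S k
  ... | true  = m≤n⇒m≤1+n (latest≤ k)
  ... | false = ≤-refl

  -- `suc n * 2` computes to `2 + n * 2`; a bound of this form places `latest k` among the endpoints
  -- of the larger diagram.
  latest<2+ : ∀ k {n} → k ≤ n → latest k < 2 + n
  latest<2+ k k≤n = s≤s (m≤n⇒m≤1+n (≤-trans (latest≤ k) k≤n))

  latest-max : ∀ {i k} → i < k → S i ≡ true → suc i ≤ latest k
  latest-max {i} {suc k} i<1+k Si with S k in Sk
  ... | true  = i<1+k
  ... | false with m<1+n⇒m<n∨m≡n i<1+k
  ...   | inj₁ i<k  = latest-max i<k Si
  ...   | inj₂ refl = contradiction (trans (sym Si) Sk) λ ()

  suc≡latest⇒source : ∀ {i} k → suc i ≡ latest k → S i ≡ true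
  suc≡latest⇒source (suc k) eq with S k in Sk
  ... | false = suc≡latest⇒source k eq
  suc≡latest⇒source (suc k) refl | true = Sk

  slot≡latest⇒source : ∀ {i} k → slot i ≡ latest k → S i ≡ true
  slot≡latest⇒source {i} k eq with S i in Si
  ... | true  = refl
  ... | false = trans (sym Si) (suc≡latest⇒source k eq)

  -- When the positions below `k` have been filled, `latest k` is the source still in transit, so it
  -- fills none of them.
  slot≢latest : ∀ {i k} → i < k → slot i ≢ latest k
  slot≢latest {i} {suc k} i<1+k eq with S k in Sk | m<1+n⇒m<n∨m≡n i<1+k
  ... | false | inj₁ i<k  = slot≢latest i<k eq
  ... | false | inj₂ refl = <⇒≢ (s≤s (latest≤ k)) (trans (sym eq) (slot-sink _ Sk))
  ... | true  | inj₁ i<k  = <⇒≢ (s≤s (≤-trans (slot≤ i) i<k)) eq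
  ... | true  | inj₂ refl =
    <⇒≢ (s≤s (latest≤ k)) (trans (sym (slot-source _ Sk)) eq)

  slot-injective-< : ∀ {i j} → i < j → slot i ≢ slot j
  slot-injective-< {i} {j} i<j eq with S j
  ... | true  = slot≢latest i<j eq
  ... | false = <⇒≢ (s≤s (≤-trans (slot≤ i) i<j)) eq

  slot-injective : ∀ {i j} → slot i ≡ slot j → i ≡ j
  slot-injective {i} {j} eq with <-cmp i j
  ... | tri< i<j _ _ = contradiction eq (slot-injective-< i<j)
  ... | tri≈ _ i≡j _ = i≡j
  ... | tri> _ _ j<i = contradiction (sym eq) (slot-injective-< j<i)

  -- Each step fills position `k` either with the source in transit, which `suc k` then replaces, or
  -- with `suc k` itself. So among the endpoints up to `k` only the source in transit is never
  -- missed by accident: it alone is still to be placed.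
  slot-surjective : ∀ {t} k → t ≤ k → t ≡ latest k ⊎ ∃ λ i → i < k × slot i ≡ t
  slot-surjective zero z≤n = inj₁ refl
  slot-surjective {t} (suc k) t≤ with m≤n⇒m<n∨m≡n t≤
  slot-surjective {t} (suc k) t≤ | inj₁ t<1+k with slot-surjective k (s≤s⁻¹ t<1+k)
  ... | inj₂ (i , i<k , eq) = inj₂ (i , m<n⇒m<1+n i<k , eq)
  ... | inj₁ eq with S k in Sk
  ...   | true  = inj₂ (k , n<1+n k , trans (slot-source _ Sk) (sym eq))
  ...   | false = inj₁ eq
  slot-surjective {t} (suc k) t≤ | inj₂ refl with S k in Sk
  ... | true  = inj₁ refl
  ... | false = inj₂ (k , n<1+n k , slot-sink _ Sk)

module _ {S S′ : ℕ → Bool} where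
  private
    module S  = Slots S
    module S′ = Slots S′

  latest-cong : ∀ k → (∀ {j} → j < k → S j ≡ S′ j) → S.latest k ≡ S′.latest k
  latest-cong zero    _  = refl
  latest-cong (suc k) eq rewrite eq (n<1+n k) | latest-cong k (eq ∘ m<n⇒m<1+n) = refl

  -- Agreement is asked only below `n`, since the source patterns to be compared are known to agree
  -- only on endpoints of the smaller diagram.
  slot-cong : ∀ {n k} → (∀ {j} → j < n → S j ≡ S′ j) → k < n → S.slot k ≡ S′.slot k
  slot-cong {k = k} eq k<n
    rewrite eq k<n | latest-cong k (λ j<k → eq (<-trans j<k k<n)) = refl

-- Diagrams as fixed-point-free involutions on natural numbers.

∀Fin⇒∀< : ∀ {m} (P : ℕ → Set) → (∀ (x : Fin m) → P (toℕ x)) → ∀ {k} → k < m → P k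
∀Fin⇒∀< P p k<m = subst P (toℕ-fromℕ< k<m) (p (fromℕ< k<m))

-- The partner map on ℕ, with junk value mate D k = k for k ≥ 2n.
mate : ∀ {n} → Diagram n → ℕ → ℕ
mate {n} D k with k <? n * 2
... | yes k<2n = toℕ (partner D (fromℕ< k<2n))
... | no  _    = k

module _ {n : ℕ} (D : Diagram n) where

  mate-toℕ : ∀ x → mate D (toℕ x) ≡ toℕ (partner D x)
  mate-toℕ x with toℕ x <? n * 2
  ... | yes x<2n = cong (toℕ ∘ partner D) (fromℕ<-toℕ x x<2n)
  ... | no  x≮2n = contradiction (toℕ<n x) x≮2n

  mate-< : ∀ {k} → k < n * 2 → mate D k < n * 2
  mate-< = ∀Fin⇒∀< (λ k → mate D k < n * 2) λ x →
    subst (_< n * 2) (sym (mate-toℕ x)) (toℕ<n _)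

  mate-involutive : ∀ {k} → k < n * 2 → mate D (mate D k) ≡ k
  mate-involutive = ∀Fin⇒∀< (λ k → mate D (mate D k) ≡ k) λ x →
    trans (cong (mate D) (mate-toℕ x))
      (trans (mate-toℕ (partner D x)) (cong toℕ (involutive D x)))

  mate-irreflexive : ∀ {k} → k < n * 2 → mate D k ≢ k
  mate-irreflexive = ∀Fin⇒∀< (λ k → mate D k ≢ k) λ x eq →
    irreflexive D x (toℕ-injective (trans (sym (mate-toℕ x)) eq))

module _ {n : ℕ} (D E : Diagram n) where

  ≈⇒mate : D ≈ E → ∀ k → mate D k ≡ mate E k
  ≈⇒mate D≈E k with k <? n * 2
  ... | yes k<2n = cong toℕ (D≈E (fromℕ< k<2n))
  ... | no  _    = refl

  mate⇒≈ : (∀ {k} → k < n * 2 → mate D k ≡ mate E k) → D ≈ E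
  mate⇒≈ eq x = toℕ-injective
    (trans (sym (mate-toℕ D x)) (trans (eq (toℕ<n x)) (mate-toℕ E x)))

module FromMate {n : ℕ} (q : ℕ → ℕ)
                (q-< : ∀ {k} → k < n * 2 → q k < n * 2)
                (q-involutive : ∀ {k} → k < n * 2 → q (q k) ≡ k)
                (q-irreflexive : ∀ {k} → k < n * 2 → q k ≢ k) where

  diagram : Diagram n
  diagram = record
    { partner     = λ x → fromℕ< (q-< (toℕ<n x))
    ; involutive  = λ x → toℕ-injective (trans (toℕ-fromℕ< (q-< (toℕ<n _)))
        (trans (cong q (toℕ-fromℕ< (q-< (toℕ<n x)))) (q-involutive (toℕ<n x))))
    ; irreflexive = λ x eq → q-irreflexive (toℕ<n x)
        (trans (sym (toℕ-fromℕ< (q-< (toℕ<n x)))) (cong toℕ eq))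
    }

  mate-diagram : ∀ {k} → k < n * 2 → mate diagram k ≡ q k
  mate-diagram = ∀Fin⇒∀< (λ k → mate diagram k ≡ q k) λ x →
    trans (mate-toℕ diagram x) (toℕ-fromℕ< (q-< (toℕ<n x)))

-- 1-terminality in terms of `mate`.

module _ {n : ℕ} (T : Diagram n) where

  -- A source `z` beyond `s` would keep the chord from `s` from being last, while the hypothesis on
  -- `u` makes that chord terminal.
  oneTerminal⇒ : OneTerminal T → ∀ {s} → s < n * 2 → s < mate T s →
    (∀ {u} → u < n * 2 → s < u → u < mate T s → ¬ mate T s < mate T u) →
    ∀ {z} → z < n * 2 → z < mate T z → z ≤ s
  oneTerminal⇒ ot {s} s<2n s<ms terminal {z} z<2n z<mz = ≮⇒≥ λ s<z →
    ot chord
      (λ last → last (toChord z<2n z<mz)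
        (subst₂ _<_ (sym (toℕ-fromℕ< s<2n)) (sym (toℕ-fromℕ< z<2n)) s<z))
      λ (d , s<d , d<b , b<b′) → terminal (toℕ<n (Chord.source d))
        (subst (_< _) (toℕ-fromℕ< s<2n) s<d)
        (subst (_ <_) (mate≡ s<2n) d<b)
        (subst₂ _<_ (mate≡ s<2n)
          (trans (cong toℕ (sym (Chord.paired d))) (sym (mate-toℕ T _))) b<b′)
    where
    mate≡ : ∀ {k} (k<2n : k < n * 2) → toℕ (partner T (fromℕ< k<2n)) ≡ mate T k
    mate≡ k<2n = trans (sym (mate-toℕ T _)) (cong (mate T) (toℕ-fromℕ< k<2n))

    toChord : ∀ {k} → k < n * 2 → k < mate T k → Chord T
    toChord k<2n k<mk = record
      { source  = fromℕ< k<2n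
      ; sink    = partner T (fromℕ< k<2n)
      ; ordered = subst₂ _<_ (sym (toℕ-fromℕ< k<2n)) (sym (mate≡ k<2n)) k<mk
      ; paired  = refl
      }

    chord : Chord T
    chord = toChord s<2n s<ms

  oneTerminal⇐ :
    (∀ {s z} → s < n * 2 → z < n * 2 → s < z → s < mate T s → z < mate T z →
      ∃ λ u → u < n * 2 × s < u × u < mate T s × mate T s < mate T u) →
    OneTerminal T
  -- `¬ Last c` is the double negation of the existence of a later source; as the goal is empty,
  -- such a source may be assumed.
  oneTerminal⇐ next c ¬last terminal = ¬last λ d s<z →
    let u , u<2n , s<u , u<ms , ms<mu =
          next (toℕ<n (source c)) (toℕ<n (source d)) s<z (s<ms c) (s<ms d)
        x = fromℕ< u<2n
        x≡u = toℕ-fromℕ< u<2n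
        mx≡mu = trans (sym (mate-toℕ T x)) (cong (mate T) x≡u)
        s<x = subst (_ <_) (sym x≡u) s<u
        x<b = subst₂ _<_ (sym x≡u) (ms≡b c) u<ms
        b<mx = subst₂ _<_ (ms≡b c) (sym mx≡mu) ms<mu
    in terminal
      ( record { source = x ; sink = partner T x ; ordered = <-trans x<b b<mx ; paired = refl }
      , s<x , x<b , b<mx )
    where
    open Chord

    ms≡b : ∀ c → mate T (toℕ (source c)) ≡ toℕ (sink c)
    ms≡b c = trans (mate-toℕ T _) (cong toℕ (paired c))

    s<ms : ∀ c → toℕ (source c) < mate T (toℕ (source c))
    s<ms c = subst (_ <_) (sym (ms≡b c)) (ordered c)

-- The shape of a 1-terminal diagram.

sourceAfter : ∀ {n} → Diagram n → ℕ → Bool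
sourceAfter T k = suc k <ᵇ mate T (suc k)

isSourceᵇ : ∀ {n} → Diagram n → ℕ → Bool
isSourceᵇ D k = k <ᵇ mate D k

module OneTerminalProperties {n : ℕ} (T : Diagram (suc n)) (ot : OneTerminal T) where

  open Slots (sourceAfter T) public

  private
    N : ℕ
    N = n * 2

    m : ℕ → ℕ
    m = mate T

  source-≤-latest : ∀ {z} k → z ≤ k → z < m z → z ≤ latest k
  source-≤-latest {zero}  k _   _    = z≤n
  source-≤-latest {suc z} k z<k z<mz = latest-max z<k (<ᵇ-true z<mz)

  latest-isSource : ∀ k → latest k < m (latest k)
  latest-isSource zero = n≢0⇒n>0 (mate-irreflexive T z<s)
  latest-isSource (suc k) with sourceAfter T k in Sk
  ... | true  = <ᵇ-true⁻¹ Sk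
  ... | false = latest-isSource k

  last-isSink : m (suc N) < suc N
  last-isSink = ≤∧≢⇒< (s≤s⁻¹ (mate-< T (n<1+n (suc N)))) (mate-irreflexive T (n<1+n (suc N)))

  -- No source lies strictly between latest k and suc k, so the chord is terminal.
  early-closing : ∀ k → k ≤ N → m (latest k) ≤ suc k →
                  ∀ {z} → z < suc n * 2 → z < m z → z ≤ latest k
  early-closing k k≤N closing = oneTerminal⇒ T ot
    (latest<2+ k k≤N)
    (latest-isSource k)
    λ {u} _ latest<u u<b b<mu → <⇒≱ latest<u
      (source-≤-latest k (s≤s⁻¹ (≤-trans u<b closing)) (<-trans u<b b<mu))

  -- No sink lies beyond `suc N`, so the chord that closes there is terminal. By 1-terminality its
  -- source is the last one, which is `latest N`.
  mate-latest : m (latest N) ≡ suc N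
  mate-latest = trans (cong m (sym s≡latest)) ms≡
    where
    ms≡ : m (m (suc N)) ≡ suc N
    ms≡ = mate-involutive T (n<1+n (suc N))

    s<ms : m (suc N) < m (m (suc N))
    s<ms = subst (m (suc N) <_) (sym ms≡) last-isSink

    s≡latest : m (suc N) ≡ latest N
    s≡latest = ≤-antisym
      (source-≤-latest N (s≤s⁻¹ last-isSink) s<ms)
      (oneTerminal⇒ T ot (m<n⇒m<1+n last-isSink) s<ms
        (λ {u} u<2n _ _ b<mu → <⇒≱ (subst (_< m u) ms≡ b<mu) (s≤s⁻¹ (mate-< T u<2n)))
        (latest<2+ N ≤-refl) (latest-isSource N))

  -- Otherwise the chord from latest k is terminal, hence the last one, which
  -- closes at suc N.
  mate-latest≢suc : ∀ {k} → k < N → m (latest k) ≢ suc k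
  mate-latest≢suc {k} k<N eq = <⇒≢ k<N (suc-injective
    (trans (sym eq) (trans (cong m latest≡) mate-latest)))
    where
    latest≡ : latest k ≡ latest N
    latest≡ = ≤-antisym
      (source-≤-latest N (≤-trans (latest≤ k) (<⇒≤ k<N)) (latest-isSource k))
      (early-closing k (<⇒≤ k<N) (≤-reflexive eq)
        (latest<2+ N ≤-refl) (latest-isSource N))

-- The graph of ψ: congruence and injectivity.

-- For 1-terminal T this relation is the graph of ψ.
record Unfolds {n : ℕ} (T : Diagram (suc n)) (D : Diagram n) : Set where
  open Slots (sourceAfter T)
  field
    mate-slot   : ∀ {i} → i < n * 2 → mate T (slot i) ≡ slot (mate D i)
    mate-latest : mate T (latest (n * 2)) ≡ suc (n * 2)

module _ {n : ℕ} {T : Diagram (suc n)} (ot : OneTerminal T) {D : Diagram n}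
         (unfolds : Unfolds T D) where

  open OneTerminalProperties T ot hiding (mate-latest)
  open Unfolds unfolds

  private
    -- Were `i` a sink of `D`, the source `latest i` of `T` would close at `slot (mate D i)`, which
    -- is at most `i`. Then `early-closing` leaves no source after `latest i`, against the one at
    -- `suc i`.
    source⇒ : ∀ {i} → i < n * 2 → sourceAfter T i ≡ true → i < mate D i
    source⇒ {i} i<N Si with <-cmp i (mate D i)
    ... | tri< i<j _ _ = i<j
    ... | tri≈ _ i≡j _ = contradiction (sym i≡j) (mate-irreflexive D i<N)
    ... | tri> _ _ j<i = contradiction
      (early-closing i (<⇒≤ i<N)
        (≤-trans (≤-reflexive (trans (cong (mate T) (sym (slot-source i Si))) (mate-slot i<N)))
          (≤-trans (slot≤ _) (m≤n⇒m≤1+n j<i)))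
        (s≤s (m<n⇒m<1+n i<N)) (<ᵇ-true⁻¹ Si))
      (<⇒≱ (s≤s (latest≤ i)))

    -- If `T` has a source just after the partner position, `source⇒` applies there. Otherwise both
    -- slots are successors, and the order of the two endpoints in `T` is their order in `D`.
    sink⇒ : ∀ {i} → i < n * 2 → sourceAfter T i ≡ false → mate D i ≤ i
    sink⇒ {i} i<N Si with sourceAfter T (mate D i) in Sj
    ... | true  = <⇒≤ (subst (mate D i <_) (mate-involutive D i<N)
                    (source⇒ (mate-< D i<N) Sj))
    ... | false = s≤s⁻¹ (subst₂ _≤_ (slot-sink (mate D i) Sj) (slot-sink i Si)
      (subst (_≤ slot i) (mate-slot i<N)
        (subst (λ k → mate T k ≤ k) (sym (slot-sink i Si)) (<ᵇ-false⁻¹ Si))))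

  -- This makes `slot` computable from `D` alone, so that `T` can be recovered from its image.
  sourceAfter≡isSourceᵇ : ∀ {i} → i < n * 2 → sourceAfter T i ≡ isSourceᵇ D i
  sourceAfter≡isSourceᵇ {i} i<N with sourceAfter T i in Si
  ... | true  = sym (<ᵇ-true (source⇒ i<N Si))
  ... | false = sym (<ᵇ-false (sink⇒ i<N Si))

-- `T` fixes `slot`, and `slot` is injective, so it can be cancelled from the equation `mate-slot`.
unfolds-cong : ∀ {n} {T T′ : Diagram (suc n)} {D D′ : Diagram n} →
               Unfolds T D → Unfolds T′ D′ → T ≈ T′ → D ≈ D′
unfolds-cong {n} {T} {T′} {D} {D′} unf unf′ T≈T′ = mate⇒≈ D D′ λ {i} i<N →
  Slots.slot-injective (sourceAfter T) (begin
    slot (mate D i)    ≡⟨ Unfolds.mate-slot unf i<N ⟨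
    mate T (slot i)    ≡⟨ ≈⇒mate T T′ T≈T′ (slot i) ⟩
    mate T′ (slot i)   ≡⟨ cong (mate T′) (slot≡ i<N) ⟩
    mate T′ (slot′ i)  ≡⟨ Unfolds.mate-slot unf′ i<N ⟩
    slot′ (mate D′ i)  ≡⟨ slot≡ (mate-< D′ i<N) ⟨
    slot (mate D′ i)   ∎)
  where
  open ≡-Reasoning
  open Slots (sourceAfter T) using (slot)
  open Slots (sourceAfter T′) using () renaming (slot to slot′)

  slot≡ : ∀ {i} → i < n * 2 → slot i ≡ slot′ i
  slot≡ = slot-cong (λ {j} _ → cong (suc j <ᵇ_) (≈⇒mate T T′ T≈T′ (suc j)))

-- The common image yields the same sources, hence the same slots. Every endpoint is a slot, the
-- last source or the last endpoint, and `Unfolds` prescribes the partner in each case.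
unfolds-injective : ∀ {n} {T T′ : Diagram (suc n)} {D D′ : Diagram n} →
                    OneTerminal T → OneTerminal T′ →
                    Unfolds T D → Unfolds T′ D′ → D ≈ D′ → T ≈ T′
unfolds-injective {n} {T} {T′} {D} {D′} ot ot′ unf unf′ D≈D′ = mate⇒≈ T T′ T≡T′
  where
  open ≡-Reasoning
  open Slots (sourceAfter T)
  open Slots (sourceAfter T′) using () renaming (slot to slot′; latest to latest′)

  N : ℕ
  N = n * 2

  S≡ : ∀ {j} → j < N → sourceAfter T j ≡ sourceAfter T′ j
  S≡ {j} j<N = begin
    sourceAfter T j   ≡⟨ sourceAfter≡isSourceᵇ ot unf j<N ⟩
    isSourceᵇ D j     ≡⟨ cong (j <ᵇ_) (≈⇒mate D D′ D≈D′ j) ⟩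
    isSourceᵇ D′ j    ≡⟨ sourceAfter≡isSourceᵇ ot′ unf′ j<N ⟨
    sourceAfter T′ j  ∎

  latest≡ : latest N ≡ latest′ N
  latest≡ = latest-cong N S≡

  mate-latest′ : mate T′ (latest N) ≡ suc N
  mate-latest′ = trans (cong (mate T′) latest≡) (Unfolds.mate-latest unf′)

  mate-last : ∀ (U : Diagram (suc n)) → mate U (latest N) ≡ suc N → mate U (suc N) ≡ latest N
  mate-last U eq = trans (cong (mate U) (sym eq))
    (mate-involutive U (latest<2+ N ≤-refl))

  T≡T′ : ∀ {k} → k < suc n * 2 → mate T k ≡ mate T′ k
  T≡T′ k< with m≤n⇒m<n∨m≡n (s≤s⁻¹ k<)
  ... | inj₂ refl = trans (mate-last T (Unfolds.mate-latest unf)) (sym (mate-last T′ mate-latest′))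
  ... | inj₁ k<1+N with slot-surjective N (s≤s⁻¹ k<1+N)
  ...   | inj₁ refl = trans (Unfolds.mate-latest unf) (sym mate-latest′)
  ...   | inj₂ (i , i<N , refl) = begin
    mate T (slot i)    ≡⟨ Unfolds.mate-slot unf i<N ⟩
    slot (mate D i)    ≡⟨ cong slot (≈⇒mate D D′ D≈D′ i) ⟩
    slot (mate D′ i)   ≡⟨ slot-cong S≡ (mate-< D′ i<N) ⟩
    slot′ (mate D′ i)  ≡⟨ Unfolds.mate-slot unf′ i<N ⟨
    mate T′ (slot′ i)  ≡⟨ cong (mate T′) (slot-cong S≡ i<N) ⟨
    mate T′ (slot i)   ∎

-- The list computation behind ψ.

data Listing {m : ℕ} (f : ℕ → ℕ) : ℕ → List (Fin m) → Set where
  []  : ∀ {k} → Listing f k []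
  _∷_ : ∀ {k x xs} → toℕ x ≡ f k → Listing f (suc k) xs → Listing f k (x ∷ xs)

lookup-listing : ∀ {m f k} {xs : List (Fin m)} → Listing f k xs →
                 ∀ j → toℕ (lookup xs j) ≡ f (k + toℕ j)
lookup-listing {f = f} {k} (eq ∷ _)  zero    = trans eq (cong f (sym (+-identityʳ k)))
lookup-listing {f = f} {k} (_  ∷ eqs) (suc j) =
  trans (lookup-listing eqs j) (cong f (sym (+-suc k (toℕ j))))

tabulate-listing : ∀ {m l} k (g : Fin l → Fin m) → (∀ j → toℕ (g j) ≡ k + toℕ j) →
                   Listing id k (tabulate g)
tabulate-listing {l = zero}  k g eq = []
tabulate-listing {l = suc l} k g eq =
  trans (eq zero) (+-identityʳ k)
  ∷ tabulate-listing (suc k) (g ∘ suc) (λ j → trans (eq (suc j)) (+-suc k (toℕ j)))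

moveSources-source : ∀ {n} (T : Diagram n) {x} xs → IsSource T x →
                     moveSources T (x ∷ xs) ≡ carry T x xs
moveSources-source T {x} xs x-source with isSource? T x
... | yes _        = refl
... | no ¬x-source = contradiction x-source ¬x-source

module Unfolding {n : ℕ} (T : Diagram (suc n)) (ot : OneTerminal T) where

  open OneTerminalProperties T ot

  private
    N : ℕ
    N = n * 2

  isSource⇒< : ∀ {x} → IsSource T x → toℕ x < mate T (toℕ x)
  isSource⇒< {x} = subst (toℕ x <_) (sym (mate-toℕ T x))

  <⇒isSource : ∀ {x} → toℕ x < mate T (toℕ x) → IsSource T x
  <⇒isSource {x} = subst (toℕ x <_) (mate-toℕ T x)

  isSource⇒≤latest : ∀ {x} → IsSource T x → toℕ x ≤ latest N
  isSource⇒≤latest {x} x-source = source-≤-latest N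
    (s≤s⁻¹ (≤-trans x-source (s≤s⁻¹ (toℕ<n (partner T x))))) (isSource⇒< x-source)

  latest⇒isSource : ∀ k {s} → toℕ s ≡ latest k → IsSource T s
  latest⇒isSource k eq = <⇒isSource (subst (λ s → s < mate T s) (sym eq) (latest-isSource k))

  partner-latest : ∀ k {s} → toℕ s ≡ latest k → toℕ (partner T s) ≡ mate T (latest k)
  partner-latest k {s} eq = trans (sym (mate-toℕ T s)) (cong (mate T) eq)

  lastSource-isSource : IsSource T (lastSource T)
  lastSource-isSource
    with argmax-sel (≤-totalOrder _) id zero (filter (isSource? T) (allFin _))
  -- The default value of `max` is itself a source, being `latest 0`.
  ... | inj₁ eq = latest⇒isSource 0 (cong toℕ eq)
  ... | inj₂ ∈sources = proj₂ (∈-filter⁻ (isSource? T) {xs = allFin _} ∈sources)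

  isSource⇒≤lastSource : ∀ {x} → IsSource T x → toℕ x ≤ toℕ (lastSource T)
  isSource⇒≤lastSource {x} x-source =
    All.lookup (xs≤max (≤-totalOrder _) zero (filter (isSource? T) (allFin _)))
      (∈-filter⁺ (isSource? T) (∈-allFin x) x-source)

  toℕ-lastSource : toℕ (lastSource T) ≡ latest N
  toℕ-lastSource = ≤-antisym (isSource⇒≤latest lastSource-isSource)
    (subst (_≤ toℕ (lastSource T)) (toℕ-fromℕ< latest<)
      (isSource⇒≤lastSource (latest⇒isSource N (toℕ-fromℕ< latest<))))
    where
    latest< : latest N < suc n * 2
    latest< = latest<2+ N ≤-refl

  toℕ-lastSink : toℕ (lastSink T) ≡ suc N
  toℕ-lastSink = trans (partner-latest N toℕ-lastSource) mate-latest

  offLastChord? : ∀ x → Dec (¬ OnLastChord T x)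
  offLastChord? = ¬? ∘ onLastChord? T

  offLastChord : ∀ {x} → toℕ x ≢ latest N → toℕ x ≢ suc N → ¬ OnLastChord T x
  offLastChord ≢latest _ (inj₁ eq) = ≢latest (trans (cong toℕ eq) toℕ-lastSource)
  offLastChord _ ≢sucN (inj₂ eq)   = ≢sucN (trans (cong toℕ eq) toℕ-lastSink)

  source-true : ∀ {k y} → toℕ y ≡ suc k → IsSource T y → sourceAfter T k ≡ true
  source-true eq y-source = <ᵇ-true (subst (λ y → y < mate T y) eq (isSource⇒< y-source))

  source-false : ∀ {k y} → toℕ y ≡ suc k → ¬ IsSource T y → sourceAfter T k ≡ false
  source-false {k} eq ¬y-source = <ᵇ-false (≮⇒≥ λ k< →
    ¬y-source (<⇒isSource (subst (λ y → y < mate T y) (sym eq) k<)))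

  ¬source⇒sink : ∀ {y} → ¬ IsSource T y → IsSink T y
  ¬source⇒sink {y} ¬y-source =
    ≤∧≢⇒< (≮⇒≥ ¬y-source) (irreflexive T y ∘ toℕ-injective)

  -- A slot below `N` is neither `latest N` nor `suc N`, so it survives the deletion of the last
  -- chord.
  filter-accept-∷ : ∀ {k x xs} → toℕ x ≡ slot k → k < N →
                    Listing slot (suc k) (filter offLastChord? xs) →
                    Listing slot k (filter offLastChord? (x ∷ xs))
  filter-accept-∷ {k} eq k<N eqs =
    subst (Listing slot k) (sym (filter-accept offLastChord? (offLastChord
      (λ x≡ → slot≢latest k<N (trans (sym eq) x≡))
      (λ x≡ → <⇒≢ (s≤s (≤-trans (slot≤ k) k<N)) (trans (sym eq) x≡)))))
      (eq ∷ eqs)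

  -- Only the last chord is left: its source is in transit and the one unread endpoint is its own
  -- sink, which it may not pass. The filter drops both.
  carry-end : ∀ {s y} → toℕ s ≡ latest N → toℕ y ≡ suc N →
              filter offLastChord? (carry T s (y ∷ [])) ≡ []
  carry-end {s} {y} s≡ y≡ with inRun? T s y | isSource? T y
  ... | yes (_ , y≢) | _ = contradiction
    (toℕ-injective (trans y≡ (sym (trans (partner-latest N s≡) mate-latest)))) y≢
  ... | no _ | yes y-source =
    contradiction (subst (_≤ latest N) y≡ (isSource⇒≤latest y-source)) (<⇒≱ (s≤s (latest≤ N)))
  ... | no _ | no _ = trans
    (filter-reject offLastChord? {xs = y ∷ []} λ off →
      off (inj₁ (toℕ-injective (trans s≡ (sym toℕ-lastSource)))))
    (filter-reject offLastChord? {xs = []} λ off →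
      off (inj₂ (toℕ-injective (trans y≡ (sym toℕ-lastSink)))))

  -- Invariant of the traversal: `latest k` is in transit, `suc k` is read next and position `k` is
  -- written next. A sink is written at once; a source takes over the transit and the previous one
  -- is written.
  carry-listing : ∀ k {s} xs → k ≤ N → toℕ s ≡ latest k → Listing id (suc k) xs →
                  k + length xs ≡ suc N →
                  Listing slot k (filter offLastChord? (carry T s xs))
  carry-listing k [] k≤N _ _ len =
    contradiction (trans (sym (+-identityʳ k)) len) (<⇒≢ (s≤s k≤N))
  carry-listing k (y ∷ ys) k≤N s≡ (y≡ ∷ ys≡) len with m≤n⇒m<n∨m≡n k≤N
  carry-listing k (y ∷ []) k≤N s≡ (y≡ ∷ ys≡) len | inj₂ refl =
    subst (Listing slot k) (sym (carry-end s≡ y≡)) []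
  carry-listing k (y ∷ y′ ∷ ys) k≤N s≡ (y≡ ∷ ys≡) len | inj₂ refl =
    contradiction (+-cancelˡ-≡ k _ 1 (trans len (+-comm 1 k))) λ ()
  carry-listing k {s} (y ∷ ys) k≤N s≡ (y≡ ∷ ys≡) len | inj₁ k<N
    with inRun? T s y | isSource? T y
  ... | yes (y-sink , _) | _ = filter-accept-∷ (trans y≡ (sym (slot-sink k Sk))) k<N
    (carry-listing (suc k) ys k<N (trans s≡ (sym (latest-sink k Sk))) ys≡
      (trans (sym (+-suc k _)) len))
    where
    Sk : sourceAfter T k ≡ false
    Sk = source-false y≡ (<⇒≯ y-sink)
  ... | no _ | yes y-source = filter-accept-∷ (trans s≡ (sym (slot-source k Sk))) k<N
    (carry-listing (suc k) ys k<N (trans y≡ (sym (latest-source k Sk))) ys≡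
      (trans (sym (+-suc k _)) len))
    where
    Sk : sourceAfter T k ≡ true
    Sk = source-true y≡ y-source
  -- A sink that ends the run would be the sink of `s` itself, at `suc k`; `mate-latest≢suc`
  -- excludes this.
  ... | no ¬inRun | no ¬y-source = contradiction
    (¬source⇒sink ¬y-source , λ y≡partner → mate-latest≢suc k<N
      (trans (sym (partner-latest k s≡)) (trans (cong toℕ (sym y≡partner)) y≡)))
    ¬inRun

  remaining-listing : Listing slot 0 (remaining T)
  remaining-listing = subst (Listing slot 0)
    -- Position 0 is a source, so the whole arrangement is a single `carry` started from it.
    (cong (filter offLastChord?) (sym (moveSources-source T _ (latest⇒isSource 0 refl))))
    (carry-listing 0 (tabulate suc) z≤n refl (tabulate-listing 1 suc λ _ → refl)
      (length-tabulate {n = suc N} suc))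

  open Relabel {n = n} T (remaining T) (remaining-unique T) (remaining-closed T) (remaining-length T)

  toℕ-endpoint : ∀ i → toℕ (endpoint i) ≡ slot (toℕ i)
  toℕ-endpoint i = trans (lookup-listing remaining-listing _)
    (cong slot (toℕ-cast (sym (remaining-length T)) i))

  unfolds : Unfolds T (moveAndDelete T)
  unfolds = record
    { mate-slot = ∀Fin⇒∀< (λ i → mate T (slot i) ≡ slot (mate (moveAndDelete T) i)) λ i → begin
        mate T (slot (toℕ i))                ≡⟨ cong (mate T) (toℕ-endpoint i) ⟨
        mate T (toℕ (endpoint i))            ≡⟨ mate-toℕ T (endpoint i) ⟩
        toℕ (partner T (endpoint i))         ≡⟨ cong toℕ (endpoint-partner′ i) ⟨
        toℕ (endpoint (partner′ i))          ≡⟨ toℕ-endpoint (partner′ i) ⟩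
        slot (toℕ (partner′ i))              ≡⟨ cong slot (mate-toℕ (moveAndDelete T) i) ⟨
        slot (mate (moveAndDelete T) (toℕ i)) ∎
    ; mate-latest = mate-latest
    }
    where open ≡-Reasoning

-- Undoing the shift: surjectivity.

-- The inverse of ψ.
module Folding {n : ℕ} (D : Diagram n) where

  open Slots (isSourceᵇ D)

  private
    N : ℕ
    N = n * 2

    p : ℕ → ℕ
    p = mate D

  -- The possible origins of an endpoint of the larger diagram: an endpoint of `D` brought to its
  -- slot, or the source or the sink of the added last chord.
  data Place (t : ℕ) : Set where
    moved  : ∀ i → i < N → slot i ≡ t → Place t
    opened : latest N ≡ t → Place t
    closed : suc N ≡ t → Place t

  place : ∀ {t} → t < suc n * 2 → Place t
  place t< with m≤n⇒m<n∨m≡n (s≤s⁻¹ t<)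
  ... | inj₂ refl = closed refl
  ... | inj₁ t<1+N with slot-surjective N (s≤s⁻¹ t<1+N)
  ...   | inj₁ refl             = opened refl
  ...   | inj₂ (i , i<N , refl) = moved i i<N refl

  mateAt : ∀ {t} → Place t → ℕ
  mateAt (moved i _ _) = slot (p i)
  mateAt (opened _)    = suc N
  mateAt (closed _)    = latest N

  slot≤N : ∀ {i} → i < N → slot i ≤ N
  slot≤N i<N = ≤-trans (slot≤ _) i<N

  -- The three origins exclude each other and `slot` is injective. Hence `q` can be evaluated at any
  -- convenient `Place`.
  mateAt-unique : ∀ {t} (a b : Place t) → mateAt a ≡ mateAt b
  mateAt-unique (moved i _ refl)  (moved j _ eq) = cong (slot ∘ p) (sym (slot-injective eq))
  mateAt-unique (moved i i<N refl) (opened eq) = contradiction (sym eq) (slot≢latest i<N)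
  mateAt-unique (moved i i<N refl) (closed eq) = contradiction (sym eq) (<⇒≢ (s≤s (slot≤N i<N)))
  mateAt-unique (opened refl) (moved j j<N eq) = contradiction eq (slot≢latest j<N)
  mateAt-unique (opened _) (opened _) = refl
  mateAt-unique (opened refl) (closed eq) = contradiction (sym eq) (<⇒≢ (s≤s (latest≤ N)))
  mateAt-unique (closed refl) (moved j j<N eq) = contradiction eq (<⇒≢ (s≤s (slot≤N j<N)))
  mateAt-unique (closed refl) (opened eq) = contradiction eq (<⇒≢ (s≤s (latest≤ N)))
  mateAt-unique (closed _) (closed _) = refl

  q : ℕ → ℕ
  q t with t <? suc n * 2
  ... | yes t< = mateAt (place t<)
  ... | no  _  = t

  q≡mateAt : ∀ {t} → t < suc n * 2 → (a : Place t) → q t ≡ mateAt a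
  q≡mateAt {t} t< a with t <? suc n * 2
  ... | yes t<′ = mateAt-unique (place t<′) a
  ... | no  t≮  = contradiction t< t≮

  slot<2n : ∀ {i} → i < N → slot i < suc n * 2
  slot<2n i<N = s≤s (m≤n⇒m≤1+n (slot≤N i<N))

  q-slot : ∀ {i} → i < N → q (slot i) ≡ slot (p i)
  q-slot i<N = q≡mateAt (slot<2n i<N) (moved _ i<N refl)

  q-latest : q (latest N) ≡ suc N
  q-latest = q≡mateAt (latest<2+ N ≤-refl) (opened refl)

  q-last : q (suc N) ≡ latest N
  q-last = q≡mateAt (n<1+n (suc N)) (closed refl)

  q-< : ∀ {t} → t < suc n * 2 → q t < suc n * 2
  q-< t< with place t<
  ... | moved i i<N refl = subst (_< suc n * 2) (sym (q-slot i<N)) (slot<2n (mate-< D i<N))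
  ... | opened refl = subst (_< suc n * 2) (sym q-latest) (n<1+n (suc N))
  ... | closed refl = subst (_< suc n * 2) (sym q-last) (latest<2+ N ≤-refl)

  q-involutive : ∀ {t} → t < suc n * 2 → q (q t) ≡ t
  q-involutive t< with place t<
  ... | moved i i<N refl = trans (cong q (q-slot i<N))
    (trans (q-slot (mate-< D i<N)) (cong slot (mate-involutive D i<N)))
  ... | opened refl = trans (cong q q-latest) q-last
  ... | closed refl = trans (cong q q-last) q-latest

  q-irreflexive : ∀ {t} → t < suc n * 2 → q t ≢ t
  q-irreflexive t< eq with place t<
  ... | moved i i<N refl = mate-irreflexive D i<N (slot-injective (trans (sym (q-slot i<N)) eq))
  ... | opened refl = <⇒≢ (s≤s (latest≤ N)) (trans (sym eq) q-latest)
  ... | closed refl = <⇒≢ (s≤s (latest≤ N)) (trans (sym q-last) eq)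

  open FromMate {suc n} q q-< q-involutive q-irreflexive public
    renaming (diagram to fold; mate-diagram to mate-fold)

  sink⇒partner< : ∀ {i} → i < N → isSourceᵇ D i ≡ false → p i < i
  sink⇒partner< i<N Si = ≤∧≢⇒< (<ᵇ-false⁻¹ Si) (mate-irreflexive D i<N)

  partner-isSink : ∀ {i} → i < N → isSourceᵇ D i ≡ true → isSourceᵇ D (p i) ≡ false
  partner-isSink i<N Si =
    <ᵇ-false (subst (_≤ p _) (sym (mate-involutive D i<N)) (<⇒≤ (<ᵇ-true⁻¹ Si)))

  q-slot-source : ∀ {i} → i < N → isSourceᵇ D i ≡ true → q (slot i) ≡ suc (p i)
  q-slot-source {i} i<N Si = trans (q-slot i<N) (slot-sink (p i) (partner-isSink i<N Si))

  q-sink : ∀ {i} → i < N → isSourceᵇ D i ≡ false → q (suc i) ≤ i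
  q-sink {i} i<N Si = ≤-trans
    (≤-reflexive (trans (cong q (sym (slot-sink i Si))) (q-slot i<N)))
    (≤-trans (slot≤ (p i)) (sink⇒partner< i<N Si))

  -- The added chord closes at the very end. Any other such endpoint is the slot of a source `i` of
  -- `D`: it goes left to `latest i` while its sink goes right to `suc (p i)`, so the chord keeps
  -- its direction.
  latest-isSource : ∀ k → k ≤ N → latest k < q (latest k)
  latest-isSource k k≤N with place (latest<2+ k k≤N)
  ... | closed eq = contradiction (sym eq) (<⇒≢ (s≤s (≤-trans (latest≤ k) k≤N)))
  ... | opened eq = subst₂ _<_ eq (trans (sym q-latest) (cong q eq)) (s≤s (latest≤ N))
  ... | moved i i<N eq = begin-strict
    latest k   ≡⟨ eq ⟨
    slot i     ≡⟨ slot-source i Si ⟩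
    latest i   ≤⟨ latest≤ i ⟩
    i          <⟨ <ᵇ-true⁻¹ Si ⟩
    p i        <⟨ n<1+n (p i) ⟩
    suc (p i)  ≡⟨ q-slot-source i<N Si ⟨
    q (slot i) ≡⟨ cong q eq ⟩
    q (latest k) ∎
    where
    open ≤-Reasoning
    Si : isSourceᵇ D i ≡ true
    Si = slot≡latest⇒source k eq

  q-source : ∀ {i} → i < N → isSourceᵇ D i ≡ true → suc i < q (suc i)
  q-source {i} i<N Si = subst (λ t → t < q t) (latest-source i Si) (latest-isSource (suc i) i<N)

  -- Consequently the slots computed from `fold` are those computed from `D`.
  sourceAfter-fold : ∀ {i} → i < N → sourceAfter fold i ≡ isSourceᵇ D i
  sourceAfter-fold {i} i<N = trans (cong (suc i <ᵇ_) (mate-fold (s≤s (m<n⇒m<1+n i<N)))) (lemma _ refl)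
    where
    lemma : ∀ b → isSourceᵇ D i ≡ b → (suc i <ᵇ q (suc i)) ≡ isSourceᵇ D i
    lemma true  Si = trans (<ᵇ-true (q-source i<N Si)) (sym Si)
    lemma false Si = trans (<ᵇ-false (m≤n⇒m≤1+n (q-sink i<N Si))) (sym Si)

  source-≤-latest : ∀ {z} → z < suc n * 2 → z < q z → z ≤ latest N
  source-≤-latest {zero}  _  _    = z≤n
  source-≤-latest {suc z} z< z<qz with m≤n⇒m<n∨m≡n (s≤s⁻¹ z<)
  ... | inj₂ refl = contradiction (subst (suc N <_) q-last z<qz) (≤⇒≯ (m≤n⇒m≤1+n (latest≤ N)))
  ... | inj₁ z<N with isSourceᵇ D z in Sz
  ...   | true  = latest-max (s≤s⁻¹ z<N) Sz
  ...   | false = contradiction (m≤n⇒m≤1+n (q-sink (s≤s⁻¹ z<N) Sz)) (<⇒≱ z<qz)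

  -- The chord from the last source before the sink of s is a right neighbour.
  rightNeighbour : ∀ {s z} → s < suc n * 2 → z < suc n * 2 → s < z → s < q s → z < q z →
                   ∃ λ u → u < suc n * 2 × s < u × u < q s × q s < q u
  rightNeighbour {s} s< z< s<z s<qs z<qz with place s<
  ... | closed refl = contradiction (subst (suc N <_) q-last s<qs) (≤⇒≯ (m≤n⇒m≤1+n (latest≤ N)))
  ... | opened refl = contradiction (source-≤-latest z< z<qz) (<⇒≱ s<z)
  ... | moved i i<N refl with isSourceᵇ D i in Si
  ...   | false = contradiction (m≤n⇒m≤1+n (q-sink i<N Si)) (<⇒≱ s<qs)
  ...   | true = u , latest<2+ (p i) (<⇒≤ pi<N)
               -- As `i` is a source of `D` before `p i`, the source `suc i` of `fold` counts
               -- towards `latest (p i)` and lies beyond `s = latest i`.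
               , ≤-trans (s≤s (latest≤ i)) (latest-max {k = p i} (<ᵇ-true⁻¹ Si) Si)
               , subst (u <_) (sym qs) (s≤s (latest≤ (p i)))
               , subst (_< q u) (sym qs) (later (place (latest<2+ (p i) (<⇒≤ pi<N))))
    where
    u : ℕ
    u = latest (p i)

    pi<N : p i < N
    pi<N = mate-< D i<N

    qs : q (latest i) ≡ suc (p i)
    qs = trans (cong q (sym (slot-source i Si))) (q-slot-source i<N Si)

    later : Place u → suc (p i) < q u
    later (closed eq) = contradiction (sym eq) (<⇒≢ (s≤s (≤-trans (latest≤ (p i)) (<⇒≤ pi<N))))
    later (opened eq) = subst (suc (p i) <_) (trans (sym q-latest) (cong q eq)) (s≤s pi<N)
    -- Slots before `p i` differ from `latest (p i)`, so `p i ≤ j`; the sink of `u` is at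
    -- `suc (p j)`, and `j < p j`.
    later (moved j j<N eq) = subst (suc (p i) <_)
      (trans (sym (q-slot-source j<N Sj)) (cong q eq))
      (s≤s (≤-<-trans (≮⇒≥ λ j<pi → slot≢latest j<pi eq) (<ᵇ-true⁻¹ Sj)))
      where
      Sj : isSourceᵇ D j ≡ true
      Sj = slot≡latest⇒source (p i) eq

  fold-oneTerminal : OneTerminal fold
  fold-oneTerminal = oneTerminal⇐ fold λ s< z< s<z s<ms z<mz →
    let ms = mate-fold s<
        u , u< , s<u , u<qs , qs<qu = rightNeighbour s< z< s<z
          (subst (_ <_) ms s<ms) (subst (_ <_) (mate-fold z<) z<mz)
    in u , u< , s<u , subst (u <_) (sym ms) u<qs
     , subst₂ _<_ (sym ms) (sym (mate-fold u<)) qs<qu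

  -- With equal slots, `Unfolds` and the definition of `q` send the partners of `i` in `E` and in
  -- `D` to the same slot.
  unfolds-fold : ∀ {E} → Unfolds fold E → E ≈ D
  unfolds-fold {E} unf = mate⇒≈ E D λ {i} i<N → slot-injective (begin
    slot (mate E i)    ≡⟨ slot≡ (mate-< E i<N) ⟨
    slot′ (mate E i)   ≡⟨ Unfolds.mate-slot unf i<N ⟨
    mate fold (slot′ i) ≡⟨ cong (mate fold) (slot≡ i<N) ⟩
    mate fold (slot i)  ≡⟨ mate-fold (slot<2n i<N) ⟩
    q (slot i)          ≡⟨ q-slot i<N ⟩
    slot (p i)          ∎)
    where
    open ≡-Reasoning
    open Slots (sourceAfter fold) using () renaming (slot to slot′)

    slot≡ : ∀ {i} → i < N → slot′ i ≡ slot i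
    slot≡ = slot-cong sourceAfter-fold

-- Assembling the bijection.

≈-isEquivalence : ∀ {n} → IsEquivalence (_≈_ {n})
≈-isEquivalence = record
  { refl  = λ _ → refl
  ; sym   = λ D≈E x → sym (D≈E x)
  ; trans = λ D≈E E≈F x → trans (D≈E x) (E≈F x)
  }

theorem8p3 : (n : ℕ) (n≥2 : 2 ≤ n) → IsBijection _≈₁_ _≈_ (ψ n≥2)
theorem8p3 (suc n) n≥2 = record
  { isInjection = record
    { isCongruent = record
      { cong           = λ {T} {T′} → ψ-cong T T′
      ; isEquivalence₁ = On.isEquivalence proj₁ ≈-isEquivalence
      ; isEquivalence₂ = ≈-isEquivalence
      }
    ; injective = λ {(T , ot)} {(T′ , ot′)} →
        unfolds-injective ot ot′ (Unfolding.unfolds T ot) (Unfolding.unfolds T′ ot′)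
    }
  -- Surjectivity is required for every diagram equivalent to the preimage, hence the passage
  -- through `ψ-cong`.
  ; surjective = λ D → let open Folding D in
      (fold , fold-oneTerminal) , λ {T} T≈fold x → trans
        (ψ-cong T (fold , fold-oneTerminal) T≈fold x)
        (unfolds-fold (Unfolding.unfolds fold fold-oneTerminal) x)
  }
  where
  ψ-cong : ∀ T T′ → T ≈₁ T′ → ψ n≥2 T ≈ ψ n≥2 T′
  ψ-cong (T , ot) (T′ , ot′) =
    unfolds-cong (Unfolding.unfolds T ot) (Unfolding.unfolds T′ ot′)
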